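{- For every integer $k \geq 4$, there is no diregular $(2,k,+3)$-digraph. That is, there is no finite digraph $G$ in which every vertex has in-degree and out-degree exactly $2$, which has exactly $1+2+2^2+\dots+2^k+3$ vertices, and which is $k$-geodetic.
   Context: A digraph $G$ is $k$-geodetic if for every ordered pair of (not necessarily distinct) vertices $x,y$ there is at most one directed path from $x$ to $y$ of length at most $k$; the trivial path of length $0$ from $x$ to $x$ counts, so in particular a $k$-geodetic digraph has no loops, no parallel arcs and no directed cycles of length at most $k$. For integers $d,k$ let $M(d,k)=1+d+d^2+\dots+d^k$ (the Moore bound). A $(d,k,+\epsilon)$-digraph is a $k$-geodetic digraph with minimum out-degree $d$ and order $M(d,k)+\epsilon$; it is diregular if every vertex has in-degree and out-degree exactly $d$. -}

module Defs where

open import Data.Fin.Base using (Fin)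
open import Data.Nat.Base using (ℕ; zero; suc; _+_; _^_; _≤_)
open import Data.Product.Base using (∃; _×_)
open import Data.Vec.Base using (sum; tabulate)
open import Relation.Binary.Construct.Closure.ReflexiveTransitive using (Star; ε; _◅_)
open import Relation.Binary.PropositionalEquality.Core using (_≡_)

-- A finite digraph with loops and parallel arcs allowed: arcs x y is the
-- number of arcs from x to y.
record Digraph : Set where
  field
    order : ℕ
    arcs  : Fin order → Fin order → ℕ

  Vertex : Set
  Vertex = Fin order

  Arc : Vertex → Vertex → Set
  Arc x y = Fin (arcs x y)

  outDegree : Vertex → ℕ
  outDegree x = sum (tabulate (λ y → arcs x y))

  inDegree : Vertex → ℕ
  inDegree y = sum (tabulate (λ x → arcs x y))

  -- Vertices may repeat along a path, so that a directed cycle through x is a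
  -- path from x to x, distinct from the trivial path ε.
  Path : Vertex → Vertex → Set
  Path = Star Arc

  length : ∀ {x y} → Path x y → ℕ
  length ε       = 0
  length (_ ◅ p) = suc (length p)

open Digraph public using (order; outDegree; inDegree)

Geodetic : ℕ → Digraph → Set
Geodetic k G = ∀ (x y : Vertex) (p q : Path x y) → length p ≤ k → length q ≤ k → p ≡ q
  where open Digraph G

MinOutDegree : ℕ → Digraph → Set
MinOutDegree d G = (∀ x → d ≤ outDegree G x) × ∃ (λ x → outDegree G x ≡ d)

Diregular : ℕ → Digraph → Set
Diregular d G = ∀ x → inDegree G x ≡ d × outDegree G x ≡ d

M : ℕ → ℕ → ℕ
M d zero    = 1
M d (suc k) = M d k + d ^ suc k

-- G is a (d, k, +e)-digraph.
record IsExcessDigraph (d k e : ℕ) (G : Digraph) : Set where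
  field
    geodetic     : Geodetic k G
    minOutDegree : MinOutDegree d G
    order≡M+e    : order G ≡ M d k + e

{-# OPTIONS --safe #-}
-- Let outliers u be the vertices at distance more than k from u. If u and v share
-- exactly one child and u′, v′ are their other children, then the trees of depth
-- k − 1 below u′ and v′ agree up to u, v and the outliers of u and v. A vertex at
-- different levels of the two trees forces its descendants to be outliers, and
-- there are too few outliers for such defects to propagate to the bottom level.
-- Hence v and v′ are outliers of u. Applying this to both children of u would
-- give too many outliers, so every vertex has a twin with the same two children.
-- Identifying twins lowers k by one and turns excess 3 into excess 2. The same
-- argument gives twins again, so the order M(2, k − 1) + 2 would be even.
module Submission where

open import Defs
open import Data.Bool.Base using (Bool; true; false; not)
open import Data.Bool.Properties using (¬-not; not-¬) renaming (_≟_ to _≟ᵇ_)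
open import Data.Empty using (⊥; ⊥-elim)
open import Data.Fin.Base using (Fin; toℕ) renaming (zero to fzero; suc to fsuc)
open import Data.Fin.Properties using (toℕ-injective; ¬Fin0) renaming (suc-injective to suc-injectiveᶠ)
open import Data.List.Base using (List; []; _∷_; _++_; _∷ʳ_; [_]; length; map; filter; allFin; initLast; _∷ʳ′_)
open import Data.List.Membership.Propositional using (_∈_; _∉_)
open import Data.List.Membership.Propositional.Properties using (∈-map⁺; ∈-map⁻; ∈-++⁺ˡ; ∈-++⁺ʳ; ∈-++⁻; ∈-∃++; ∈-filter⁺; ∈-filter⁻; ∈-allFin)
open import Data.List.Properties using (length-++; length-map; length-tabulate; ++-assoc; ++-identityʳ; ++-cancelˡ; ∷-injectiveˡ; ∷-injectiveʳ; ∷ʳ-injectiveˡ)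
open import Data.List.Relation.Binary.Subset.Propositional using (_⊆_)
open import Data.List.Relation.Unary.All using ([]; _∷_)
import Data.List.Relation.Unary.All as All
import Data.List.Relation.Unary.All.Properties as All
open import Data.List.Relation.Unary.AllPairs using ([]; _∷_)
open import Data.List.Relation.Unary.Any using (here; there)
open import Data.List.Relation.Unary.Unique.Propositional using (Unique)
import Data.List.Relation.Unary.Unique.Propositional.Properties as Unique
open import Data.Nat.Base using (ℕ; zero; suc; _+_; _*_; _^_; _∸_; _≤_; _<_; z≤n; s≤s)
open import Data.Nat.Properties using (≤-refl; ≤-trans; ≤-reflexive; ≤-antisym; ≤-pred; <-irrefl; <-asym; <-irrelevant; ≤∧≢⇒<; *-distribˡ-+; *-cancelˡ-≡; even≢odd; <⇒≤; <⇒≢; ≮⇒≥; _<?_; <-cmp; +-suc; +-comm; +-identityʳ; +-cancelˡ-≤; +-cancelˡ-≡; +-monoˡ-≤; ^-monoʳ-≤; m≤m+n; m≤n+m; n≤1+n; m+[n∸m]≡n; suc-injective; module ≤-Reasoning) renaming (_≟_ to _≟ⁿ_)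
open import Data.Product.Base using (∃; _×_; _,_; proj₁; proj₂)
open import Data.Sum.Base as Sum using (_⊎_; inj₁; inj₂)
open import Data.Vec.Base using (sum; tabulate)
open import Function.Base using (_∘_; id)
open import Relation.Binary.Construct.Closure.ReflexiveTransitive using (ε; _◅_)
open import Relation.Binary.Definitions using (DecidableEquality; tri<; tri≈; tri>)
open import Relation.Binary.PropositionalEquality using (_≡_; _≢_; refl; sym; trans; cong; cong₂; subst; ≢-sym; module ≡-Reasoning)
open import Relation.Nullary.Decidable.Core using (Dec; yes; no; map′; ¬?)
open import Relation.Nullary.Negation.Core using (¬_; contradiction)

-- Pigeonhole for lists

-- Write K = k - 1. The bound on k comes from a charging argument: a path of length K below v′ whose
-- end has no counterpart at the same level below u′ yields K different outliers of u. When the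
-- excess is at most K, these are all the outliers, so each of them is located on the path or beside
-- it. The condition reads 3 ≤ k - 1 in the given digraph and 2 ≤ k - 2 after twins are identified,
-- so `Core` serves both rounds. The obstacle is that v might be no outlier of u: it could lie at
-- distance exactly K + 1 from u, through u′. The path from u′ to v is then such a path with the
-- roles of u and v exchanged, and the located outliers leave a rigid configuration that has to be
-- refuted separately. Paths are words over `Bool`, so that levels, prefixes and siblings become
-- facts about lists.

unique-⊆⇒≤ : ∀ {A : Set} {xs ys : List A} → Unique xs → xs ⊆ ys → length xs ≤ length ys
unique-⊆⇒≤ {xs = []}     _          _     = z≤n
unique-⊆⇒≤ {xs = x ∷ xs} (x∉xs ∷ u) xs⊆ys with ∈-∃++ (xs⊆ys (here refl))
... | as , bs , refl = begin
  suc (length xs)            ≤⟨ s≤s (unique-⊆⇒≤ u rest) ⟩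
  suc (length (as ++ bs))    ≡⟨ cong suc (length-++ as) ⟩
  suc (length as + length bs) ≡⟨ +-suc (length as) (length bs) ⟨
  length as + suc (length bs) ≡⟨ length-++ as ⟨
  length (as ++ x ∷ bs)      ∎
  where
  open ≤-Reasoning
  rest : xs ⊆ as ++ bs
  rest y∈xs with ∈-++⁻ as (xs⊆ys (there y∈xs))
  ... | inj₁ y∈as         = ∈-++⁺ˡ y∈as
  ... | inj₂ (here refl)  = contradiction refl (All.lookup x∉xs y∈xs)
  ... | inj₂ (there y∈bs) = ∈-++⁺ʳ as y∈bs

-- Injectivity is asked only on members of the list, because geodecity separates only words of
-- bounded length.
unique-map : ∀ {A B : Set} {f : A → B} {xs} → (∀ {x y} → x ∈ xs → y ∈ xs → f x ≡ f y → x ≡ y) →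
             Unique xs → Unique (map f xs)
unique-map inj []         = []
unique-map inj (x∉xs ∷ u) =
  All.map⁺ (All.tabulate λ y∈xs fx≡fy → All.lookup x∉xs y∈xs (inj (here refl) (there y∈xs) fx≡fy))
  ∷ unique-map (λ p q → inj (there p) (there q)) u

∉⇒All≢ : ∀ {A : Set} {x : A} {xs} → x ∉ xs → All.All (x ≢_) xs
∉⇒All≢ x∉xs = All.tabulate λ y∈xs x≡y → x∉xs (subst (_∈ _) (sym x≡y) y∈xs)

-- Words

Word : Set
Word = List Bool

words : ℕ → List Word
words zero    = [ [] ]
words (suc j) = map (false ∷_) (words j) ++ map (true ∷_) (words j)

words≤ : ℕ → List Word
words≤ zero    = words zero
words≤ (suc j) = words≤ j ++ words (suc j)

length-words : ∀ j → length (words j) ≡ 2 ^ j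
length-words zero    = refl
length-words (suc j) = begin
  length (map (false ∷_) (words j) ++ map (true ∷_) (words j)) ≡⟨ length-++ (map (false ∷_) (words j)) ⟩
  length (map (false ∷_) (words j)) + length (map (true ∷_) (words j))
    ≡⟨ cong₂ _+_ (length-map (false ∷_) (words j)) (length-map (true ∷_) (words j)) ⟩
  length (words j) + length (words j) ≡⟨ cong₂ _+_ (length-words j) (length-words j) ⟩
  2 ^ j + 2 ^ j                       ≡⟨ cong (2 ^ j +_) (+-identityʳ (2 ^ j)) ⟨
  2 ^ suc j                           ∎
  where open ≡-Reasoning

length-words≤ : ∀ j → length (words≤ j) ≡ M 2 j
length-words≤ zero    = refl
length-words≤ (suc j) = trans (length-++ (words≤ j)) (cong₂ _+_ (length-words≤ j) (length-words (suc j)))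

∈-words⁺ : ∀ w → w ∈ words (length w)
∈-words⁺ []          = here refl
∈-words⁺ (false ∷ w) = ∈-++⁺ˡ (∈-map⁺ (false ∷_) (∈-words⁺ w))
∈-words⁺ (true ∷ w)  = ∈-++⁺ʳ (map (false ∷_) (words (length w))) (∈-map⁺ (true ∷_) (∈-words⁺ w))

∈-words⁻ : ∀ j {w} → w ∈ words j → length w ≡ j
∈-words⁻ zero    (here refl) = refl
∈-words⁻ (suc j) w∈          with ∈-++⁻ (map (false ∷_) (words j)) w∈
... | inj₁ w∈₀ with ∈-map⁻ (false ∷_) w∈₀
...   | _ , v∈ , refl = cong suc (∈-words⁻ j v∈)
∈-words⁻ (suc j) w∈ | inj₂ w∈₁ with ∈-map⁻ (true ∷_) w∈₁
...   | _ , v∈ , refl = cong suc (∈-words⁻ j v∈)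

words-unique : ∀ j → Unique (words j)
words-unique zero    = [] ∷ []
words-unique (suc j) = Unique.++⁺ (Unique.map⁺ ∷-injectiveʳ (words-unique j)) (Unique.map⁺ ∷-injectiveʳ (words-unique j)) disjoint
  where
  disjoint : ∀ {w} → w ∈ map (false ∷_) (words j) × w ∈ map (true ∷_) (words j) → ⊥
  disjoint (w∈₀ , w∈₁) with ∈-map⁻ (false ∷_) w∈₀ | ∈-map⁻ (true ∷_) w∈₁
  ... | _ , _ , refl | _ , _ , ()

∈-words≤⁺ : ∀ j {w} → length w ≤ j → w ∈ words≤ j
∈-words≤⁺ zero    {[]} _ = here refl
∈-words≤⁺ (suc j) {w}  l with length w <? suc j
... | yes (s≤s l′) = ∈-++⁺ˡ (∈-words≤⁺ j l′)
... | no  l≮       = ∈-++⁺ʳ (words≤ j) (subst (λ i → w ∈ words i) (≤-antisym l (≮⇒≥ l≮)) (∈-words⁺ w))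

∈-words≤⁻ : ∀ j {w} → w ∈ words≤ j → length w ≤ j
∈-words≤⁻ zero    (here refl) = z≤n
∈-words≤⁻ (suc j) w∈          with ∈-++⁻ (words≤ j) w∈
... | inj₁ w∈₁ = ≤-trans (∈-words≤⁻ j w∈₁) (n≤1+n j)
... | inj₂ w∈₂ = ≤-reflexive (∈-words⁻ (suc j) w∈₂)

words≤-unique : ∀ j → Unique (words≤ j)
words≤-unique zero    = words-unique zero
words≤-unique (suc j) = Unique.++⁺ (words≤-unique j) (words-unique (suc j))
  λ (w∈₁ , w∈₂) → <-irrefl (∈-words⁻ (suc j) w∈₂) (s≤s (∈-words≤⁻ j w∈₁))

length-∷ʳ : ∀ (w : Word) b → length (w ∷ʳ b) ≡ suc (length w)
length-∷ʳ w b = trans (length-++ w) (+-comm (length w) 1)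

-- Geodetic systems

follow : {V : Set} → (Bool → V → V) → Word → V → V
follow child []      x = x
follow child (b ∷ w) x = follow child w (child b x)

-- The out-arcs of every vertex are labelled by Bool, so that a path from x of
-- length j is a word of length j.
record System (k : ℕ) : Set₁ where
  field
    V             : Set
    idx           : V → ℕ
    idx-injective : ∀ {x y} → idx x ≡ idx y → x ≡ y
    vertices      : List V
    unique        : Unique vertices
    complete      : ∀ x → x ∈ vertices
    child         : Bool → V → V

  act : Word → V → V
  act = follow child

  Parent : V → V → Set
  Parent u x = ∃ λ b → child b u ≡ x

  field
    geodetic : ∀ {x} w w′ → length w ≤ k → length w′ ≤ k → act w x ≡ act w′ x → w ≡ w′
    parents  : ∀ x → ∃ λ u → ∃ λ v → u ≢ v × Parent u x × Parent v x ×
                     (∀ {w} → Parent w x → w ≡ u ⊎ w ≡ v)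

  Twin : V → V → Set
  Twin u v = ∀ b → Parent v (child b u)

  _≟_ : DecidableEquality V
  x ≟ y = map′ idx-injective (cong idx) (idx x ≟ⁿ idx y)

  act-++ : ∀ w z x → act (w ++ z) x ≡ act z (act w x)
  act-++ []      z x = refl
  act-++ (b ∷ w) z x = act-++ w z (child b x)

  same-length : ∀ {x} w w′ → length w ≤ k → length w′ ≤ k → act w x ≡ act w′ x → length w ≡ length w′
  same-length w w′ l l′ eq = cong length (geodetic w w′ l l′ eq)

  other-parent : ∀ {u x} → Parent u x → ∃ λ v → v ≢ u × Parent v x
  other-parent {u} {x} Pux with parents x
  ... | p , q , p≢q , Pp , Pq , only with only Pux
  ...   | inj₁ refl = q , ≢-sym p≢q , Pq
  ...   | inj₂ refl = p , p≢q , Pp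

-- Outliers of a vertex

module Outliers {k e} (S : System k) (order≤ : length (System.vertices S) ≤ M 2 k + e) where

  open System S
  open import Data.List.Membership.DecPropositional _≟_ using (_∈?_) public

  tree : V → List V
  tree u = map (λ w → act w u) (words≤ k)

  outliers : V → List V
  outliers u = filter (λ y → ¬? (y ∈? tree u)) vertices

  -- By geodecity `tree u` lists M(2, k) different vertices, which leaves at most e others.
  length-outliers : ∀ u → length (outliers u) ≤ e
  length-outliers u = +-cancelˡ-≤ (M 2 k) _ _ (begin
    M 2 k + length (outliers u)             ≡⟨ cong (_+ length (outliers u)) (length-words≤ k) ⟨
    length (words≤ k) + length (outliers u) ≡⟨ cong (_+ length (outliers u)) (length-map _ (words≤ k)) ⟨
    length (tree u) + length (outliers u)   ≡⟨ length-++ (tree u) ⟨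
    length (tree u ++ outliers u)           ≤⟨ unique-⊆⇒≤ distinct (λ _ → complete _) ⟩
    length vertices                         ≤⟨ order≤ ⟩
    M 2 k + e                               ∎)
    where
    open ≤-Reasoning
    distinct : Unique (tree u ++ outliers u)
    distinct = Unique.++⁺
      (unique-map (λ w∈ w′∈ → geodetic _ _ (∈-words≤⁻ k w∈) (∈-words≤⁻ k w′∈)) (words≤-unique k))
      (Unique.filter⁺ _ unique)
      (λ (y∈T , y∈O) → proj₂ (∈-filter⁻ (λ y → ¬? (y ∈? tree u)) {xs = vertices} y∈O) y∈T)

  reached-or-outlier : ∀ u y → (∃ λ w → length w ≤ k × act w u ≡ y) ⊎ y ∈ outliers u
  reached-or-outlier u y with y ∈? tree u
  ... | no  y∉T = inj₂ (∈-filter⁺ _ (complete y) y∉T)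
  ... | yes y∈T with ∈-map⁻ _ y∈T
  ...   | w , w∈ , eq = inj₁ (w , ∈-words≤⁻ k w∈ , sym eq)

  outlier-unreached : ∀ {u y} w → y ∈ outliers u → length w ≤ k → act w u ≢ y
  outlier-unreached {u} w y∈O l refl =
    proj₂ (∈-filter⁻ (λ y → ¬? (y ∈? tree u)) {xs = vertices} y∈O) (∈-map⁺ (λ w → act w u) (∈-words≤⁺ k {w} l))

  -- Once e different outliers are known there is no room for another. This turns a count into a
  -- location for every outlier.
  outliers-exhausted : ∀ {u xs} → Unique xs → xs ⊆ outliers u → e ≤ length xs → outliers u ⊆ xs
  outliers-exhausted {u} {xs} uniq xs⊆O e≤ {y} y∈O with y ∈? xs
  ... | yes y∈xs = y∈xs
  ... | no  y∉xs = contradiction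
    (≤-trans (unique-⊆⇒≤ (∉⇒All≢ y∉xs ∷ uniq) λ { (here refl) → y∈O ; (there x∈) → xs⊆O x∈ })
             (≤-trans (length-outliers u) e≤))
    (<-irrefl refl)

-- Pairs of vertices with exactly one common child

module Core {K e} (S : System (suc K)) (2≤K : 2 ≤ K) (e≤3 : e ≤ 3) (e≤K : e ≤ K)
            (order≤ : length (System.vertices S) ≤ M 2 (suc K) + e) where

  open System S
  open Outliers S order≤

  no-cycle : ∀ {x} b w → length w ≤ K → act (b ∷ w) x ≢ x
  no-cycle b w l eq = contradiction (geodetic (b ∷ w) [] (s≤s l) z≤n eq) λ ()

  first-letter : ∀ {x b b′} w w′ → length w ≤ K → length w′ ≤ K → b ≢ b′ →
                 act (b ∷ w) x ≢ act (b′ ∷ w′) x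
  first-letter w w′ l l′ b≢b′ eq = b≢b′ (∷-injectiveˡ (geodetic (_ ∷ w) (_ ∷ w′) (s≤s l) (s≤s l′) eq))

  four-outliers : ∀ {u a b c d} → a ∈ outliers u → b ∈ outliers u → c ∈ outliers u → d ∈ outliers u →
                  a ≢ b → a ≢ c → a ≢ d → b ≢ c → b ≢ d → c ≢ d → ⊥
  four-outliers {u} {a} {b} {c} {d} a∈ b∈ c∈ d∈ a≢b a≢c a≢d b≢c b≢d c≢d =
    contradiction (≤-trans (unique-⊆⇒≤ uniq incl) (≤-trans (length-outliers u) e≤3)) (<-irrefl refl)
    where
    uniq : Unique (a ∷ b ∷ c ∷ d ∷ [])
    uniq = (a≢b ∷ a≢c ∷ a≢d ∷ []) ∷ (b≢c ∷ b≢d ∷ []) ∷ (c≢d ∷ []) ∷ [] ∷ []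
    incl : a ∷ b ∷ c ∷ d ∷ [] ⊆ outliers u
    incl (here refl)                         = a∈
    incl (there (here refl))                 = b∈
    incl (there (there (here refl)))         = c∈
    incl (there (there (there (here refl)))) = d∈

  -- u and v have exactly one common child; u′ and v′ are their other children.
  record Pair (u v : V) : Set where
    field
      bu au bv av : Bool
      au≢bu       : au ≢ bu
      av≢bv       : av ≢ bv
      u≢v         : u ≢ v
      shared      : child bu u ≡ child bv v

    u′ : V
    u′ = child au u

    v′ : V
    v′ = child av v

    field
      u′≢v′ : u′ ≢ v′

  -- The modules over a `Pair` are closed and reopened so that their earlier results can also be
  -- applied to `swap P`.
  swap : ∀ {u v} → Pair u v → Pair v u
  swap P = record
    { bu = bv ; au = av ; bv = bu ; av = au ; au≢bu = av≢bv ; av≢bv = au≢bu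
    ; u≢v = ≢-sym u≢v ; shared = sym shared ; u′≢v′ = ≢-sym u′≢v′ }
    where open Pair P

  -- A short path from u to v starts with a child of u. That is also a child of v, so a short cycle
  -- through v results.
  twin-outlier : ∀ {u v} → u ≢ v → Twin u v → v ∈ outliers u
  twin-outlier {u} {v} u≢v twin with reached-or-outlier u v
  ... | inj₂ v∈O                   = v∈O
  ... | inj₁ ([] , _ , u≡v)         = contradiction u≡v u≢v
  ... | inj₁ (b ∷ t , s≤s l , eq)   with twin b
  ...   | b′ , b′v≡bu = contradiction (trans (cong (act t) b′v≡bu) eq) (no-cycle b′ t l)

  -- Comparing the trees below u′ and v′

  module _ {u v} (P : Pair u v) where
    open Pair P

    -- A short path from u to this vertex cannot begin with the shared child: v would then reach the
    -- vertex through both of its children.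
    classify : ∀ w → length w ≤ K →
               act w v′ ∈ outliers u ⊎ act w v′ ≡ u ⊎ ∃ λ t → length t ≤ K × act t u′ ≡ act w v′
    classify w l with reached-or-outlier u (act w v′)
    ... | inj₂ o                     = inj₁ o
    ... | inj₁ ([] , _ , eq)         = inj₂ (inj₁ (sym eq))
    ... | inj₁ (b ∷ t , s≤s lt , eq) with b ≟ᵇ bu
    ...   | yes refl = contradiction (trans (cong (act t) (sym shared)) eq) (first-letter t w lt l (≢-sym av≢bv))
    ...   | no  b≢bu with trans (¬-not b≢bu) (sym (¬-not au≢bu))
    ...     | refl = inj₂ (inj₂ (t , lt , eq))

    -- If u lay higher, one more step would lead from v through v′ and u to the shared child, in
    -- competition with the arc from v.
    partner-at-bottom : ∀ w → length w ≤ K → act w v′ ≡ u → length w ≡ K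
    partner-at-bottom w l eq with length w <? K
    ... | no  l≮K = ≤-antisym l (≮⇒≥ l≮K)
    ... | yes l<K = contradiction
      (trans (act-++ w [ bu ] v′) (trans (cong (child bu) eq) shared))
      (first-letter (w ∷ʳ bu) [] (≤-trans (≤-reflexive (length-∷ʳ w bu)) l<K) z≤n av≢bv)

    -- The word `t ++ z` has length K + 1, still within the range of geodecity, so no word of length
    -- at most K leads from u′ to the same vertex.
    below : ∀ t w z → act t u′ ≡ act w v′ → length t + length z ≡ suc K → length (w ++ z) ≤ K →
            act (w ++ z) v′ ∈ outliers u ⊎ act (w ++ z) v′ ≡ u
    below t w z eq lt lw with classify (w ++ z) lw
    ... | inj₁ o                      = inj₁ o
    ... | inj₂ (inj₁ eqᵤ)             = inj₂ eqᵤ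
    ... | inj₂ (inj₂ (t′ , lt′ , eq′)) = contradiction
      (trans (same-length t′ (t ++ z) (≤-trans lt′ (n≤1+n K)) (≤-reflexive l) eq″) l)
      (<⇒≢ (s≤s lt′))
      where
      l : length (t ++ z) ≡ suc K
      l = trans (length-++ t) lt
      eq″ : act t′ u′ ≡ act (t ++ z) u′
      eq″ = begin
        act t′ u′          ≡⟨ eq′ ⟩
        act (w ++ z) v′    ≡⟨ act-++ w z v′ ⟩
        act z (act w v′)   ≡⟨ cong (act z) eq ⟨
        act z (act t u′)   ≡⟨ act-++ t z u′ ⟨
        act (t ++ z) u′    ∎
        where open ≡-Reasoning

    -- A vertex at level |w| below v′ and at a larger level |t| below u′: its
    -- descendants at distance K + 1 from u′ are too far down to lie below u′ again,
    -- so they are in u ∷ outliers u, which has at most four elements.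
    module _ (t w : Word) (eq : act t u′ ≡ act w v′) (w<t : length w < length t)
             (r : ℕ) (t+r : length t + r ≡ suc K) where

      fan : List V
      fan = map (λ z → act (w ++ z) v′) (words r)

      fan-length : ∀ z → z ∈ words r → length (w ++ z) ≤ K
      fan-length z z∈ = ≤-pred (begin
        suc (length (w ++ z))       ≡⟨ cong suc (length-++ w) ⟩
        suc (length w) + length z   ≡⟨ cong (suc (length w) +_) (∈-words⁻ r z∈) ⟩
        suc (length w) + r          ≤⟨ +-monoˡ-≤ r w<t ⟩
        length t + r                ≡⟨ t+r ⟩
        suc K                       ∎)
        where open ≤-Reasoning

      fan-unique : Unique fan
      fan-unique = unique-map
        (λ {z} {z′} z∈ z′∈ eq → ++-cancelˡ w z z′
          (geodetic (w ++ z) (w ++ z′) (≤-trans (fan-length z z∈) (n≤1+n K)) (≤-trans (fan-length z′ z′∈) (n≤1+n K)) eq))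
        (words-unique r)

      fan⊆ : fan ⊆ u ∷ outliers u
      fan⊆ y∈ with ∈-map⁻ _ y∈
      ... | z , z∈ , refl with below t w z eq (trans (cong (length t +_) (∈-words⁻ r z∈)) t+r) (fan-length z z∈)
      ...   | inj₁ o    = there o
      ...   | inj₂ y≡u = here y≡u

      fan-small : 2 ^ r ≤ suc e
      fan-small = begin
        2 ^ r                    ≡⟨ length-words r ⟨
        length (words r)         ≡⟨ length-map _ (words r) ⟨
        length fan               ≤⟨ unique-⊆⇒≤ fan-unique fan⊆ ⟩
        suc (length (outliers u)) ≤⟨ s≤s (length-outliers u) ⟩
        suc e                    ∎
        where open ≤-Reasoning

      fan-exhausts : suc e ≤ 2 ^ r → u ∷ outliers u ⊆ fan
      fan-exhausts e<2^r {y} y∈ with y ∈? fan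
      ... | yes y∈fan = y∈fan
      ... | no  y∉fan = contradiction (begin
        suc (2 ^ r)                ≡⟨ cong suc (length-words r) ⟨
        suc (length (words r))     ≡⟨ cong suc (length-map _ (words r)) ⟨
        length (y ∷ fan)           ≤⟨ unique-⊆⇒≤ (∉⇒All≢ y∉fan ∷ fan-unique) (λ { (here refl) → y∈ ; (there x∈) → fan⊆ x∈ }) ⟩
        suc (length (outliers u))  ≤⟨ s≤s (length-outliers u) ⟩
        suc e                      ≤⟨ e<2^r ⟩
        2 ^ r                      ∎) (<-irrefl refl)
        where open ≤-Reasoning

    -- The tight case r = 2 of the fan: its four vertices include u and every outlier of u. All of
    -- them lie at level K below v′, because u does.
    Exceptional : Word → Word → Set
    Exceptional t w = suc (length t) ≡ K × 2 + length w ≡ K × 3 ≤ K ×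
                      (∀ {y} → y ∈ outliers u → ∃ λ κ → length κ ≡ K × act κ v′ ≡ y)

    -- With |t| + r = K + 1, a fan of 2 ^ r vertices must fit among u and at most three outliers. So
    -- r is 1 or 2, and r = 2 leaves no slack.
    shift : ∀ t w → act t u′ ≡ act w v′ → length w < length t → length t ≤ K →
            length t ≡ K ⊎ Exceptional t w
    shift t w eq w<t t≤K = go (suc K ∸ length t) (m+[n∸m]≡n (≤-trans t≤K (n≤1+n K)))
      where
      go : ∀ r → length t + r ≡ suc K → length t ≡ K ⊎ Exceptional t w
      go 0 t+r = contradiction (trans (sym (+-identityʳ _)) t+r) (<⇒≢ (s≤s t≤K))
      go 1 t+r = inj₁ (suc-injective (trans (+-comm 1 (length t)) t+r))
      go 2 t+r with ∈-map⁻ _ (exhausts (here refl))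
        where
        exhausts : u ∷ outliers u ⊆ fan t w eq w<t 2 t+r
        exhausts = fan-exhausts t w eq w<t 2 t+r (s≤s e≤3)
      ... | z , z∈ , u≡ = inj₂
        ( suc-injective (trans (+-comm 2 (length t)) t+r)
        , w+2≡K
        , ≤-trans (≤-pred (fan-small t w eq w<t 2 t+r)) e≤K
        , λ y∈O → level (∈-map⁻ _ (fan-exhausts t w eq w<t 2 t+r (s≤s e≤3) (there y∈O))) )
        where
        len : ∀ {z} → z ∈ words 2 → length (w ++ z) ≡ 2 + length w
        len z∈ = trans (length-++ w) (trans (cong (length w +_) (∈-words⁻ 2 z∈)) (+-comm (length w) 2))
        w+2≡K : 2 + length w ≡ K
        w+2≡K = trans (sym (len z∈)) (partner-at-bottom (w ++ z) (fan-length t w eq w<t 2 t+r z z∈) (sym u≡))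
        level : ∀ {y} → (∃ λ z → z ∈ words 2 × y ≡ act (w ++ z) v′) → ∃ λ κ → length κ ≡ K × act κ v′ ≡ y
        level (z , z∈ , y≡) = w ++ z , trans (len z∈) w+2≡K , sym y≡
      go (suc (suc (suc r))) t+r = contradiction
        (≤-trans (^-monoʳ-≤ 2 {3} {3 + r} (s≤s (s≤s (s≤s z≤n))))
          (≤-trans (fan-small t w eq w<t (suc (suc (suc r))) t+r) (s≤s e≤3)))
        λ { (s≤s (s≤s (s≤s (s≤s ())))) }

    outlier-unreached-here : ∀ t w → length t ≤ K → act t u′ ≡ act w v′ → act w v′ ∉ outliers u
    outlier-unreached-here t w l eq o = outlier-unreached (au ∷ t) o (s≤s l) eq

  -- Level shifts reach the bottom

  module _ {u v} (P : Pair u v) where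
    open Pair P

    private
      clash : ∀ {m} → suc m ≢ m
      clash ()

    -- As 3 ≤ K, the shifted vertex has a parent at level K - 3 below v′, too high to be u or an
    -- outlier of u. So the parent also occurs below u′. A smaller level there contradicts `shift`
    -- for `swap P`. The same level would give the vertex two levels below u′. A larger level must
    -- be K, and then `below` makes the vertex itself u or an outlier.
    no-exception : ∀ t w → act t u′ ≡ act w v′ → ¬ Exceptional P t w
    no-exception t w eq (t+1 , w+2 , 3≤K , level) with initLast w
    ... | []       = contradiction (subst (3 ≤_) (sym w+2) 3≤K) λ { (s≤s (s≤s ())) }
    ... | w₁ ∷ʳ′ b = parent (classify P w₁ (≤-trans (n≤1+n _) (<⇒≤ w₁+1<K)))
      where
      w₁+3 : 3 + length w₁ ≡ K
      w₁+3 = trans (cong (2 +_) (sym (length-∷ʳ w₁ b))) w+2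
      w₁+1<K : 2 + length w₁ ≤ K
      w₁+1<K = ≤-trans (n≤1+n _) (≤-reflexive w₁+3)
      w₁<K : length w₁ < K
      w₁<K = ≤-trans (n≤1+n _) w₁+1<K
      t≡ : length t ≡ 2 + length w₁
      t≡ = suc-injective (trans t+1 (sym w₁+3))
      t≤K : length t ≤ K
      t≤K = ≤-trans (n≤1+n _) (≤-reflexive t+1)
      parent : act w₁ v′ ∈ outliers u ⊎ act w₁ v′ ≡ u ⊎ (∃ λ t₁ → length t₁ ≤ K × act t₁ u′ ≡ act w₁ v′) → ⊥
      parent (inj₁ o) with level o
      ... | κ , lκ , eqκ = <⇒≢ w₁<K (trans (sym (same-length κ w₁ (≤-trans (≤-reflexive lκ) (n≤1+n K)) (≤-trans (<⇒≤ w₁<K) (n≤1+n K)) eqκ)) lκ)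
      parent (inj₂ (inj₁ eqᵤ)) = <⇒≢ w₁<K (partner-at-bottom P w₁ (<⇒≤ w₁<K) eqᵤ)
      parent (inj₂ (inj₂ (t₁ , lt₁ , eq₁))) with <-cmp (length t₁) (length w₁)
      ... | tri< t₁<w₁ _ _ with shift (swap P) w₁ t₁ (sym eq₁) t₁<w₁ (<⇒≤ w₁<K)
      ...   | inj₁ w₁≡K              = <⇒≢ w₁<K w₁≡K
      ...   | inj₂ (w₁+1≡K , _) = <⇒≢ w₁+1<K w₁+1≡K
      parent (inj₂ (inj₂ (t₁ , lt₁ , eq₁))) | tri≈ _ t₁≡w₁ _ =
        clash (trans (sym t≡) (trans (same-length t (t₁ ∷ʳ b) (≤-trans t≤K (n≤1+n K)) l (trans eq step))
                (trans (length-∷ʳ t₁ b) (cong suc t₁≡w₁))))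
        where
        l : length (t₁ ∷ʳ b) ≤ suc K
        l = ≤-trans (≤-reflexive (length-∷ʳ t₁ b)) (s≤s lt₁)
        step : act (w₁ ∷ʳ b) v′ ≡ act (t₁ ∷ʳ b) u′
        step = trans (act-++ w₁ [ b ] v′) (trans (cong (child b) (sym eq₁)) (sym (act-++ t₁ [ b ] u′)))
      parent (inj₂ (inj₂ (t₁ , lt₁ , eq₁))) | tri> _ _ w₁<t₁ with shift P t₁ w₁ eq₁ w₁<t₁ lt₁
      ... | inj₂ (_ , w₁+2≡K , _) = <⇒≢ w₁+1<K′ w₁+2≡K
        where
        w₁+1<K′ : 2 + length w₁ < K
        w₁+1<K′ = ≤-reflexive w₁+3
      ... | inj₁ t₁≡K with below P t₁ w₁ [ b ] eq₁ (trans (+-comm _ 1) (cong suc t₁≡K)) lw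
        where
        lw : length (w₁ ∷ʳ b) ≤ K
        lw = ≤-trans (n≤1+n _) (≤-trans (n≤1+n _) (≤-reflexive w+2))
      ...   | inj₁ o   = outlier-unreached-here P t (w₁ ∷ʳ b) t≤K eq o
      ...   | inj₂ y≡u = <⇒≢ (≤-trans (n≤1+n _) (≤-reflexive w+2)) (partner-at-bottom P (w₁ ∷ʳ b) (≤-trans (n≤1+n _) (≤-trans (n≤1+n _) (≤-reflexive w+2))) y≡u)

    shifted-to-bottom : ∀ t w → act t u′ ≡ act w v′ → length w < length t → length t ≤ K → length t ≡ K
    shifted-to-bottom t w eq w<t t≤K with shift P t w eq w<t t≤K
    ... | inj₁ t≡K = t≡K
    ... | inj₂ exc = contradiction exc (no-exception t w eq)

    Good : Word → Set
    Good w = ∃ λ t → length t ≡ length w × act t u′ ≡ act w v′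

    -- Used for |w| < K, where it is the only kind of shift to a larger level that
    -- `shifted-to-bottom` permits.
    Sunk : Word → Set
    Sunk w = ∃ λ t → length t ≡ K × act t u′ ≡ act w v′

    good-++ : ∀ p q → Good p → Good (p ++ q)
    good-++ p q (t , lt , eq) = t ++ q
      , trans (length-++ t) (trans (cong (_+ length q) lt) (sym (length-++ p)))
      , trans (act-++ t q u′) (trans (cong (act q) eq) (sym (act-++ p q v′)))

    sunk-child : ∀ w → length w < K → Sunk w → ∀ b → act (w ∷ʳ b) v′ ∈ outliers u ⊎ act (w ∷ʳ b) v′ ≡ u
    sunk-child w w<K (t , lt , eq) b =
      below P t w [ b ] eq (trans (+-comm _ 1) (cong suc lt)) (≤-trans (≤-reflexive (length-∷ʳ w b)) w<K)

  -- Charging outliers along a path that is not good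

  module _ {u v} (P : Pair u v) where
    open Pair P

    status : ∀ w → length w < K → Good P w ⊎ act w v′ ∈ outliers u ⊎ Sunk P w
    status w w<K with classify P w (<⇒≤ w<K)
    ... | inj₁ o                    = inj₂ (inj₁ o)
    ... | inj₂ (inj₁ eqᵤ)           = contradiction (partner-at-bottom P w (<⇒≤ w<K) eqᵤ) (<⇒≢ w<K)
    ... | inj₂ (inj₂ (t , lt , eq)) with <-cmp (length t) (length w)
    ...   | tri< t<w _ _ = contradiction (shifted-to-bottom (swap P) w t (sym eq) t<w (<⇒≤ w<K)) (<⇒≢ w<K)
    ...   | tri≈ _ t≡w _ = inj₁ (t , t≡w , eq)
    ...   | tri> _ _ w<t = inj₂ (inj₂ (t , shifted-to-bottom P t w eq w<t lt , eq))

    Prefix : Word → Word → Set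
    Prefix κ w = ∃ λ z → κ ++ z ≡ w

    BesideSunk : Word → Word → Set
    BesideSunk κ w = ∃ λ p → ∃ λ b → ∃ λ z → κ ≡ p ∷ʳ not b × p ++ b ∷ z ≡ w × length p < K × Sunk P p

    Charge : Word → Word → Set
    Charge w κ = act κ v′ ∈ outliers u × length κ ≤ K × (Prefix κ w ⊎ BesideSunk κ w)

    -- If w is not good then no prefix of w is good. A proper prefix leads to an
    -- outlier, charged to itself, or is sunk, charged to one of its children.
    charges : ∀ w p q → p ++ q ≡ w → length w ≡ K → ¬ Good P w →
              ∃ λ L → length L ≡ length q × Unique L × (∀ {κ} → κ ∈ L → Prefix p κ × Charge w κ)
    charges w p []      _  _  _  = [] , refl , [] , λ ()
    charges w p (b ∷ q) eq lw ng with status p p<K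
      where
      p<K : length p < K
      p<K = begin
        suc (length p)             ≤⟨ s≤s (m≤m+n (length p) (length q)) ⟩
        suc (length p + length q)  ≡⟨ +-suc (length p) (length q) ⟨
        length p + suc (length q)  ≡⟨ length-++ p ⟨
        length (p ++ b ∷ q)        ≡⟨ cong length eq ⟩
        length w                   ≡⟨ lw ⟩
        K                          ∎
        where open ≤-Reasoning
    ... | inj₁ g = contradiction (subst (Good P) eq (good-++ P p (b ∷ q) g)) ng
    ... | inj₂ st with charges w (p ∷ʳ b) q (trans (++-assoc p [ b ] q) eq) lw ng
    ...   | L , len , uniq , ch = pick st
      where
      lp : suc (length p) + length q ≡ K
      lp = trans (sym (+-suc (length p) (length q))) (trans (sym (length-++ p)) (trans (cong length eq) lw))
      p<K : length p < K
      p<K = subst (length p <_) lp (s≤s (m≤m+n (length p) (length q)))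
      extend : ∀ {κ} → Prefix (p ∷ʳ b) κ → Prefix p κ
      extend (z , refl) = b ∷ z , sym (++-assoc p [ b ] z)
      child≤K : ∀ b′ → length (p ∷ʳ b′) ≤ K
      child≤K b′ = ≤-trans (≤-reflexive (length-∷ʳ p b′)) p<K
      add : ∀ κ → κ ∉ L → Prefix p κ → Charge w κ →
            ∃ λ L → length L ≡ suc (length q) × Unique L × (∀ {κ} → κ ∈ L → Prefix p κ × Charge w κ)
      add κ κ∉L pre c = κ ∷ L , cong suc len , ∉⇒All≢ κ∉L ∷ uniq
        , λ { (here refl) → pre , c ; (there κ′∈) → extend (proj₁ (ch κ′∈)) , proj₂ (ch κ′∈) }
      pick : act p v′ ∈ outliers u ⊎ Sunk P p →
             ∃ λ L → length L ≡ suc (length q) × Unique L × (∀ {κ} → κ ∈ L → Prefix p κ × Charge w κ)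
      pick (inj₁ o) = add p p∉L ([] , ++-identityʳ p) (o , <⇒≤ p<K , inj₁ (b ∷ q , eq))
        where
        p∉L : p ∉ L
        p∉L p∈L with ch p∈L
        ... | (z , eq′) , _ with ++-cancelˡ p (b ∷ z) [] (trans (sym (++-assoc p [ b ] z)) (trans eq′ (sym (++-identityʳ p))))
        ...   | ()
      -- The child off the path has priority, since the child on the path may be charged by the next
      -- prefix.
      pick (inj₂ s) with sunk-child P p p<K s (not b)
      ... | inj₁ o = add (p ∷ʳ not b) sib∉L ([ not b ] , refl) (o , child≤K (not b) , inj₂ (p , b , q , refl , eq , p<K , s))
        where
        sib∉L : p ∷ʳ not b ∉ L
        sib∉L ∈L with ch ∈L
        ... | (z , eq′) , _ =
          not-¬ refl (∷-injectiveˡ (++-cancelˡ p (b ∷ z) [ not b ] (trans (sym (++-assoc p [ b ] z)) eq′)))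
      -- If the sibling is u, it is at level K. So p is the last proper prefix, and `L` is still
      -- empty.
      ... | inj₂ y≡u with sunk-child P p p<K s b
      ...   | inj₂ x≡u = contradiction
        (trans (trans (sym (act-++ p [ b ] v′)) x≡u) (trans (sym y≡u) (act-++ p [ not b ] v′)))
        (first-letter [] [] z≤n z≤n (not-¬ refl))
      ...   | inj₁ o   = add (p ∷ʳ b) ∉L ([ b ] , refl) (o , child≤K b , inj₁ (q , trans (++-assoc p [ b ] q) eq))
        where
        q≡0 : length q ≡ 0
        q≡0 = +-cancelˡ-≡ (suc (length p)) _ _ (begin
          suc (length p) + length q  ≡⟨ lp ⟩
          K                          ≡⟨ partner-at-bottom P (p ∷ʳ not b) (child≤K (not b)) y≡u ⟨
          length (p ∷ʳ not b)        ≡⟨ length-∷ʳ p (not b) ⟩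
          suc (length p)             ≡⟨ +-identityʳ (suc (length p)) ⟨
          suc (length p) + 0         ∎)
          where open ≡-Reasoning
        ∉L : p ∷ʳ b ∉ L
        ∉L ∈L = nonempty (trans len q≡0) ∈L
          where
          nonempty : ∀ {κ L} → length L ≡ 0 → κ ∉ L
          nonempty () (here _)
          nonempty () (there _)

    -- The K charged vertices are different outliers and e ≤ K, so no outlier escapes.
    outlier-charged : ∀ w {y} → length w ≡ K → ¬ Good P w → y ∈ outliers u → ∃ λ κ → act κ v′ ≡ y × Charge w κ
    outlier-charged w lw ng y∈O with charges w [] w refl lw ng
    ... | L , len , uniq , ch with ∈-map⁻ (λ κ → act κ v′) (outliers-exhausted
            (unique-map (λ κ∈ κ′∈ → geodetic _ _ (bound κ∈) (bound κ′∈)) uniq)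
            charged
            (≤-trans e≤K (≤-reflexive (sym (trans (length-map _ L) (trans len lw)))))
            y∈O)
      where
      bound : ∀ {κ} → κ ∈ L → length κ ≤ suc K
      bound κ∈ = ≤-trans (proj₁ (proj₂ (proj₂ (ch κ∈)))) (n≤1+n K)
      charged : map (λ κ → act κ v′) L ⊆ outliers u
      charged z∈ with ∈-map⁻ _ z∈
      ... | _ , κ∈ , refl = proj₁ (proj₂ (ch κ∈))
    ...   | κ , κ∈ , y≡ = κ , sym y≡ , proj₂ (ch κ∈)

    -- Charged vertices lie at most K levels below v′, so v among them would close a short cycle.
    partner-not-outlier : ∀ w → length w ≡ K → ¬ Good P w → v ∉ outliers u
    partner-not-outlier w lw ng v∈O with outlier-charged w lw ng v∈O
    ... | κ , κv′≡v , _ , lκ , _ = no-cycle av κ lκ κv′≡v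

    -- The way in which v can fail to be an outlier of u: the path has to use u′, and
    -- `partner-at-bottom` for `swap P` fixes its length.
    Return : Set
    Return = ∃ λ τ → length τ ≡ K × act τ u′ ≡ v

    outlier-or-return : v ∈ outliers u ⊎ Return
    outlier-or-return with reached-or-outlier u v
    ... | inj₂ o                     = inj₁ o
    ... | inj₁ ([] , _ , u≡v)        = contradiction u≡v u≢v
    ... | inj₁ (b ∷ t , s≤s lt , eq) with b ≟ᵇ bu
    ...   | yes refl = contradiction (trans (cong (act t) (sym shared)) eq) (no-cycle bv t lt)
    ...   | no  b≢bu with trans (¬-not b≢bu) (sym (¬-not au≢bu))
    ...     | refl = inj₂ (t , partner-at-bottom (swap P) t lt eq , eq)

    return-not-good : ((τ , _) : Return) → ¬ Good (swap P) τ
    return-not-good (τ , lτ , eq) (t , lt , eq′) = no-cycle av t (≤-reflexive (trans lt lτ)) (trans eq′ eq)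

  -- Excluding a return

  module _ {u v} (P : Pair u v) where
    open Pair P

    return-swap : Return P → Return (swap P)
    return-swap r@(τ , lτ , _) with outlier-or-return (swap P)
    ... | inj₁ o  = contradiction o (partner-not-outlier (swap P) τ lτ (return-not-good P r))
    ... | inj₂ r′ = r′

    -- Consider the parent z of the sunk vertex at level K - 1 below u′. The only consistent case is
    -- that z is an outlier of v standing beside the path τ; its charge there supplies the sunk p′,
    -- at level K - 2.
    sunk-forces : Return P → ∀ p → length p < K → Sunk P p →
                  suc (length p) ≡ K × ∃ λ p′ → suc (length p′) < K × Sunk (swap P) p′
    sunk-forces r@(τ , lτ , τu′≡v) p p<K (t , lt , eq) with initLast t
    ... | []       = contradiction (subst (2 ≤_) (sym lt) 2≤K) λ ()
    ... | t₀ ∷ʳ′ b = parent (status (swap P) t₀ t₀<K)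
      where
      lt₀ : suc (length t₀) ≡ K
      lt₀ = trans (sym (length-∷ʳ t₀ b)) lt
      t₀<K : length t₀ < K
      t₀<K = ≤-reflexive lt₀
      z : V
      z = act t₀ u′
      bz≡ : child b z ≡ act p v′
      bz≡ = trans (sym (act-++ t₀ [ b ] u′)) eq
      parent : Good (swap P) t₀ ⊎ z ∈ outliers v ⊎ Sunk (swap P) t₀ →
               suc (length p) ≡ K × ∃ λ p′ → suc (length p′) < K × Sunk (swap P) p′
      parent (inj₁ (s , ls , eqₛ)) = contradiction
        (trans (sym (same-length (s ∷ʳ b) p (≤-trans (≤-reflexive lsb) (n≤1+n K)) (≤-trans (<⇒≤ p<K) (n≤1+n K))
          (trans (act-++ s [ b ] v′) (trans (cong (child b) eqₛ) bz≡)))) lsb)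
        (<⇒≢ p<K)
        where
        lsb : length (s ∷ʳ b) ≡ K
        lsb = trans (length-∷ʳ s b) (trans (cong suc ls) lt₀)
      parent (inj₂ (inj₂ s)) with sunk-child (swap P) t₀ t₀<K s b
      ... | inj₁ o   = contradiction (sym eq) (outlier-unreached (av ∷ p) o (s≤s (<⇒≤ p<K)))
      ... | inj₂ y≡v = contradiction (trans (sym eq) y≡v) (no-cycle av p (<⇒≤ p<K))
      parent (inj₂ (inj₁ o)) with outlier-charged (swap P) τ lτ (return-not-good P r) o
      ... | κ , κ≡ , _ , lκ , pos with geodetic κ t₀ (≤-trans lκ (n≤1+n K)) (≤-trans (<⇒≤ t₀<K) (n≤1+n K)) κ≡
      ...   | refl = locate pos
        where
        locate : Prefix (swap P) t₀ τ ⊎ BesideSunk (swap P) t₀ τ →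
                 suc (length p) ≡ K × ∃ λ p′ → suc (length p′) < K × Sunk (swap P) p′
        -- With z on τ, the walk z → v → v′ continues to the child b of z in |p| + 2 ≤ K + 1 steps,
        -- in competition with the arc.
        locate (inj₁ (ζ , refl)) = contradiction
          (begin
            act (ζ ++ av ∷ p) z    ≡⟨ act-++ ζ (av ∷ p) z ⟩
            act (av ∷ p) (act ζ z) ≡⟨ cong (act (av ∷ p)) (act-++ t₀ ζ u′) ⟨
            act (av ∷ p) (act (t₀ ++ ζ) u′) ≡⟨ cong (act (av ∷ p)) τu′≡v ⟩
            act p v′               ≡⟨ bz≡ ⟨
            child b z              ∎)
          λ eq′ → <⇒≢ (s≤s (s≤s z≤n)) (trans (sym (same-length (ζ ++ av ∷ p) [ b ] long (s≤s z≤n) eq′)) lζ)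
          where
          open ≡-Reasoning
          lζ₁ : length ζ ≡ 1
          lζ₁ = +-cancelˡ-≡ (length t₀) _ _ (trans (sym (length-++ t₀)) (trans lτ (trans (sym lt₀) (+-comm 1 _))))
          lζ : length (ζ ++ av ∷ p) ≡ 2 + length p
          lζ = trans (length-++ ζ) (cong (_+ suc (length p)) lζ₁)
          long : length (ζ ++ av ∷ p) ≤ suc K
          long = ≤-trans (≤-reflexive lζ) (s≤s p<K)
        locate (inj₂ (p′ , b′ , ζ , refl , refl , _ , s)) with suc (length p) <? K
        ... | no  p≮  = ≤-antisym p<K (≮⇒≥ p≮) , p′ , ≤-reflexive lp′ , s
          where
          lp′ : 2 + length p′ ≡ K
          lp′ = trans (cong suc (sym (length-∷ʳ p′ (not b′)))) lt₀
        -- Two paths from the sunk parent q of z to the child of z: one follows τ to v and descends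
        -- through v′, the other passes through z.
        ... | yes p+1<K = contradiction
          (begin
            act (b′ ∷ ζ ++ av ∷ p) q    ≡⟨ act-++ (b′ ∷ ζ) (av ∷ p) q ⟩
            act (av ∷ p) (act (b′ ∷ ζ) q) ≡⟨ cong (act (av ∷ p)) (act-++ p′ (b′ ∷ ζ) u′) ⟨
            act (av ∷ p) (act (p′ ++ b′ ∷ ζ) u′) ≡⟨ cong (act (av ∷ p)) τu′≡v ⟩
            act p v′                    ≡⟨ bz≡ ⟨
            child b (act (p′ ∷ʳ not b′) u′) ≡⟨ cong (child b) (act-++ p′ [ not b′ ] u′) ⟩
            act (not b′ ∷ [ b ]) q      ∎)
          (first-letter (ζ ++ av ∷ p) [ b ] long (≤-trans (s≤s z≤n) p<K) (not-¬ refl))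
          where
          open ≡-Reasoning
          q : V
          q = act p′ u′
          lp′ : 2 + length p′ ≡ K
          lp′ = trans (cong suc (sym (length-∷ʳ p′ (not b′)))) lt₀
          lζ₁ : length ζ ≡ 1
          lζ₁ = suc-injective (+-cancelˡ-≡ (length p′) _ _ (trans (sym (length-++ p′)) (trans lτ (trans (sym lp′) (+-comm 2 _)))))
          long : length (ζ ++ av ∷ p) ≤ K
          long = ≤-trans (≤-reflexive (trans (length-++ ζ) (cong (_+ suc (length p)) lζ₁))) p+1<K

  module _ {u v} (P : Pair u v) where
    open Pair P

    -- `sunk-forces` produces a sunk p′ above level K - 1 on the other side; applied there, it puts
    -- p′ on level K - 1.
    no-sunk : Return P → ∀ p → length p < K → ¬ Sunk P p
    no-sunk r p p<K s with sunk-forces P r p p<K s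
    ... | _ , p′ , p′+1<K , s′ with sunk-forces (swap P) (return-swap P r) p′ (<⇒≤ p′+1<K) s′
    ...   | p′+1≡K , _ = <⇒≢ p′+1<K p′+1≡K

    outlier-on-return : Return P → ((w , _) : Return (swap P)) → ∀ {y} → y ∈ outliers u →
                        ∃ λ κ → act κ v′ ≡ y × length κ ≤ K × Prefix P κ w
    outlier-on-return r r′@(w , lw , _) y∈O with outlier-charged P w lw (return-not-good (swap P) r′) y∈O
    ... | κ , eq , _ , lκ , inj₁ pre                       = κ , eq , lκ , pre
    ... | _ , _ , _ , _ , inj₂ (p , _ , _ , _ , _ , p<K , s) = contradiction s (no-sunk r p p<K)

    -- A vertex above level K below v′ that is not good is by now an outlier of u, and these all lie
    -- on the path w.
    off-return-good : Return P → ((w , _) : Return (swap P)) → ∀ {b b₁ w₁} → w ≡ b₁ ∷ w₁ → b ≢ b₁ →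
                      Parent u′ (child b v′)
    off-return-good r r′ {b} w≡ b≢b₁ with status P [ b ] 2≤K
    ... | inj₁ (b₀ ∷ [] , refl , eq) = b₀ , eq
    ... | inj₂ (inj₂ s)              = contradiction s (no-sunk r [ b ] 2≤K)
    ... | inj₂ (inj₁ o) with outlier-on-return r r′ o
    ...   | κ , eq , lκ , ζ , κζ≡w with geodetic κ [ b ] (≤-trans lκ (n≤1+n K)) (s≤s z≤n) eq
    ...     | refl = contradiction (∷-injectiveˡ (trans κζ≡w w≡)) b≢b₁

    v′-outlier : (∀ p → length p < K → ¬ Sunk P p) → v′ ∈ outliers u
    v′-outlier unsunk with status P [] (≤-trans (s≤s z≤n) 2≤K)
    ... | inj₁ ([] , _ , u′≡v′) = contradiction u′≡v′ u′≢v′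
    ... | inj₂ (inj₁ o)         = o
    ... | inj₂ (inj₂ s)         = contradiction s (unsunk [] (≤-trans (s≤s z≤n) 2≤K))

  -- When v is not an outlier of u, the outliers of u are the inner vertices of
  -- a path v → v′ → ⋯ → u. The same path would serve the other parent x of u′,
  -- and its sibling at the second step would be a child of both children of u.
  no-return : ∀ {u v} (P : Pair u v) → ¬ Return P
  no-return {u} {v} P r with other-parent {u} {Pair.u′ P} (Pair.au P , refl)
  ... | x , x≢u , bx , bxx≡u′ = second (child (not bx) x ≟ child bu u)
    where
    open Pair P
    r′ : Return (swap P)
    r′ = return-swap P r
    w : Word
    w = proj₁ r′
    -- As an outlier, x would lie on w and reach u′ through u as well as directly. Geodecity makes
    -- the detour trivial, so x = u.
    x∉O : x ∉ outliers u
    x∉O x∈O with outlier-on-return P r r′ x∈O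
    ... | κ , κv′≡x , lκ , ζ , κζ≡w = x≢u (start ζ (geodetic (ζ ∷ʳ au) [ bx ] lζ (s≤s z≤n)
          (trans (act-++ ζ [ au ] x) (trans (cong (child au) ζx≡u) (sym bxx≡u′)))) ζx≡u)
      where
      ζx≡u : act ζ x ≡ u
      ζx≡u = begin
        act ζ x            ≡⟨ cong (act ζ) κv′≡x ⟨
        act ζ (act κ v′)   ≡⟨ act-++ κ ζ v′ ⟨
        act (κ ++ ζ) v′    ≡⟨ cong (λ w → act w v′) κζ≡w ⟩
        act w v′           ≡⟨ proj₂ (proj₂ r′) ⟩
        u                  ∎
        where open ≡-Reasoning
      lζ : length (ζ ∷ʳ au) ≤ suc K
      lζ = ≤-trans (≤-reflexive (length-∷ʳ ζ au)) (s≤s (begin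
        length ζ              ≤⟨ m≤n+m (length ζ) (length κ) ⟩
        length κ + length ζ   ≡⟨ length-++ κ ⟨
        length (κ ++ ζ)       ≡⟨ cong length κζ≡w ⟩
        length w              ≡⟨ proj₁ (proj₂ r′) ⟩
        K                     ∎))
        where open ≤-Reasoning
      start : ∀ ζ → ζ ∷ʳ au ≡ [ bx ] → act ζ x ≡ u → x ≡ u
      start []          _  x≡u = x≡u
      start (_ ∷ [])    () _
      start (_ ∷ _ ∷ _) () _
    second : Dec (child (not bx) x ≡ child bu u) → ⊥
    second (yes twin) = x∉O (twin-outlier (≢-sym x≢u) common)
      where
      common : Twin u x
      common b with b ≟ᵇ bu
      ... | yes refl = not bx , twin
      ... | no  b≢bu with trans (¬-not b≢bu) (sym (¬-not au≢bu))
      ...   | refl = bx , bxx≡u′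
    second (no ¬twin) = third (outlier-or-return Q)
      where
      Q : Pair u x
      Q = record
        { bu = au ; au = bu ; bv = bx ; av = not bx ; au≢bu = ≢-sym au≢bu ; av≢bv = ≢-sym (not-¬ refl)
        ; u≢v = ≢-sym x≢u ; shared = sym bxx≡u′ ; u′≢v′ = ≢-sym ¬twin }
      third : x ∈ outliers u ⊎ Return Q → ⊥
      third (inj₁ o) = x∉O o
      -- The other child x′ of x is an outlier of u, hence on w. Its own path to u has full length
      -- K, which forces x′ = v′ and the same word.
      third (inj₂ s) with return-swap Q s | outlier-on-return P r r′ (v′-outlier Q (no-sunk Q s))
      ... | s′@(w* , lw* , w*x′≡u) | κ , κv′≡x′ , lκ , ζ , κζ≡w = conclude κ κv′≡x′ κζ≡w lκζ
        (geodetic ζ w* lζ (≤-trans (≤-reflexive lw*) (n≤1+n K)) (trans ζx′≡u (sym w*x′≡u)))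
        where
        x′ : V
        x′ = child (not bx) x
        ζx′≡u : act ζ x′ ≡ u
        ζx′≡u = begin
          act ζ x′           ≡⟨ cong (act ζ) κv′≡x′ ⟨
          act ζ (act κ v′)   ≡⟨ act-++ κ ζ v′ ⟨
          act (κ ++ ζ) v′    ≡⟨ cong (λ w → act w v′) κζ≡w ⟩
          act w v′           ≡⟨ proj₂ (proj₂ r′) ⟩
          u                  ∎
          where open ≡-Reasoning
        lκζ : length κ + length ζ ≡ K
        lκζ = trans (sym (length-++ κ)) (trans (cong length κζ≡w) (proj₁ (proj₂ r′)))
        lζ : length ζ ≤ suc K
        lζ = ≤-trans (m≤n+m (length ζ) (length κ)) (≤-trans (≤-reflexive lκζ) (n≤1+n K))
        1≤K : 1 ≤ K
        1≤K = ≤-trans (s≤s z≤n) 2≤K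
        clash : ∀ w₀ → length w₀ ≡ K → v′ ≡ x′ → w ≡ w₀ → w* ≡ w₀ → ⊥
        clash []        l _      _  _   = contradiction (subst (1 ≤_) (sym l) 1≤K) λ ()
        clash (b₁ ∷ w₁) _ v′≡x′ w≡ w*≡
          with off-return-good P r r′ {not b₁} w≡ (≢-sym (not-¬ refl)) | off-return-good Q s s′ {not b₁} w*≡ (≢-sym (not-¬ refl))
        ... | b₀ , eq₀ | b₂ , eq₂ =
          first-letter [ b₀ ] [ b₂ ] 1≤K 1≤K au≢bu (trans eq₀ (trans (cong (child (not b₁)) v′≡x′) (sym eq₂)))
        conclude : ∀ κ → act κ v′ ≡ x′ → κ ++ ζ ≡ w → length κ + length ζ ≡ K → ζ ≡ w* → ⊥
        conclude []      v′≡x′ ζ≡w _ ζ≡w* = clash w (proj₁ (proj₂ r′)) v′≡x′ refl (trans (sym ζ≡w*) ζ≡w)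
        conclude (_ ∷ κ) _      _   l ζ≡w* =
          <⇒≢ (s≤s (m≤n+m (length ζ) (length κ))) (trans (cong length ζ≡w*) (trans lw* (sym l)))

  -- Existence of twins

  partner-outlier : ∀ {u v} → Pair u v → v ∈ outliers u
  partner-outlier P with outlier-or-return P
  ... | inj₁ o = o
  ... | inj₂ r = contradiction r (no-return P)

  module _ {u v} (P : Pair u v) where
    open Pair P

    -- The occurrence at level K below u′ would not be good for `swap P`, so `partner-not-outlier`
    -- would contradict `partner-outlier`.
    never-sunk : ∀ p → length p < K → ¬ Sunk P p
    never-sunk p p<K (t , lt , eq) = partner-not-outlier (swap P) t lt not-good (partner-outlier (swap P))
      where
      not-good : ¬ Good (swap P) t
      not-good (s , ls , eqₛ) = <⇒≢ p<K (trans
        (same-length p s (≤-trans (<⇒≤ p<K) (n≤1+n K)) (≤-trans (≤-reflexive (trans ls lt)) (n≤1+n K)) (sym (trans eqₛ eq)))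
        (trans ls lt))

    other-child-outlier : v′ ∈ outliers u
    other-child-outlier = v′-outlier P never-sunk

    grandchild : ∀ b → child b v′ ∈ outliers u ⊎ Parent u′ (child b v′)
    grandchild b with status P [ b ] 2≤K
    ... | inj₁ (b₀ ∷ [] , refl , eq) = inj₂ (b₀ , eq)
    ... | inj₂ (inj₁ o)              = inj₁ o
    ... | inj₂ (inj₂ s)              = contradiction s (never-sunk [ b ] 2≤K)

  module _ {u v} (u≢v : u ≢ v) (bu : Bool) (bv : Bool) (shared : child bu u ≡ child bv v) where

    twin-or-pair : Twin u v ⊎ child (not bu) u ≢ child (not bv) v
    twin-or-pair with child (not bu) u ≟ child (not bv) v
    ... | no  ≢  = inj₂ ≢
    ... | yes eq = inj₁ common
      where
      common : Twin u v
      common b with b ≟ᵇ bu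
      ... | yes refl = bv , sym shared
      ... | no  b≢bu with ¬-not b≢bu
      ...   | refl = not bv , sym eq

    mkPair : child (not bu) u ≢ child (not bv) v → Pair u v
    mkPair u′≢v′ = record
      { bu = bu ; au = not bu ; bv = bv ; av = not bv ; au≢bu = ≢-sym (not-¬ refl) ; av≢bv = ≢-sym (not-¬ refl)
      ; u≢v = u≢v ; shared = shared ; u′≢v′ = u′≢v′ }

  has-twin : ∀ u → ∃ λ v → v ≢ u × Twin u v
  has-twin u with other-parent {u} (false , refl) | other-parent {u} (true , refl)
  ... | v , v≢u , bv , v≡ | w , w≢u , bw , w≡
    with twin-or-pair (≢-sym v≢u) false bv (sym v≡) | twin-or-pair (≢-sym w≢u) true bw (sym w≡)
  ... | inj₁ t  | _       = v , v≢u , t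
  ... | inj₂ _  | inj₁ t  = w , w≢u , t
  ... | inj₂ dv | inj₂ dw = ⊥-elim (four-outliers v∈O v′∈O w∈O w′∈O v≢v′ v≢w v≢w′ v′≢w v′≢w′ w≢w′)
    where
    P : Pair u v
    P = mkPair (≢-sym v≢u) false bv (sym v≡) dv
    Q : Pair u w
    Q = mkPair (≢-sym w≢u) true bw (sym w≡) dw
    v′ w′ : V
    v′ = child (not bv) v
    w′ = child (not bw) w
    1≤K : 1 ≤ K
    1≤K = ≤-trans (s≤s z≤n) 2≤K
    v∈O : v ∈ outliers u
    v∈O = partner-outlier P
    w∈O : w ∈ outliers u
    w∈O = partner-outlier Q
    v′∈O : v′ ∈ outliers u
    v′∈O = other-child-outlier P
    w′∈O : w′ ∈ outliers u
    w′∈O = other-child-outlier Q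
    v≢v′ : v ≢ v′
    v≢v′ eq = no-cycle (not bv) [] z≤n (sym eq)
    w≢w′ : w ≢ w′
    w≢w′ eq = no-cycle (not bw) [] z≤n (sym eq)
    v≢w : v ≢ w
    v≢w refl with bw ≟ᵇ bv
    ... | yes refl = first-letter [] [] z≤n z≤n (λ ()) (trans (sym v≡) w≡)
    ... | no  bw≢bv with ¬-not bw≢bv
    ...   | refl = dv (sym w≡)
    -- Otherwise w reaches the child `false` of u through v in two steps, but that child is an
    -- outlier of w.
    v≢w′ : v ≢ w′
    v≢w′ eq = outlier-unreached (not bw ∷ [ bv ]) (other-child-outlier (swap Q)) (s≤s 1≤K)
      (trans (cong (child bv) (sym eq)) v≡)
    v′≢w : v′ ≢ w
    v′≢w eq = outlier-unreached (not bv ∷ [ bw ]) (other-child-outlier (swap P)) (s≤s 1≤K)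
      (trans (cong (child bw) eq) w≡)
    -- If v′ = w′, then its child is the missing fourth outlier or a child of both children of u.
    v′≢w′ : v′ ≢ w′
    v′≢w′ eq with grandchild P false | grandchild Q false
    ... | inj₁ o | _ = four-outliers v∈O v′∈O w∈O o v≢v′ v≢w
            (λ eq′ → no-cycle (not bv) [ false ] 1≤K (sym eq′)) v′≢w
            (λ eq′ → no-cycle false [] z≤n (sym eq′))
            (λ eq′ → no-cycle (not bw) [ false ] 1≤K (trans (cong (child false) (sym eq)) (sym eq′)))
    ... | inj₂ _ | inj₁ o = four-outliers v∈O v′∈O w∈O (subst (λ y → child false y ∈ outliers u) (sym eq) o) v≢v′ v≢w
            (λ eq′ → no-cycle (not bv) [ false ] 1≤K (sym eq′)) v′≢w
            (λ eq′ → no-cycle false [] z≤n (sym eq′))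
            (λ eq′ → no-cycle (not bw) [ false ] 1≤K (trans (cong (child false) (sym eq)) (sym eq′)))
    ... | inj₂ (b₁ , eq₁) | inj₂ (b₂ , eq₂) =
      first-letter [ b₁ ] [ b₂ ] 1≤K 1≤K (λ ()) (trans eq₁ (trans (cong (child false) eq) (sym eq₂)))

-- Identifying twins

map-proj₁-toList : ∀ {A : Set} {Q : A → Set} {xs} (pxs : All.All Q xs) → map proj₁ (All.toList pxs) ≡ xs
map-proj₁-toList []         = refl
map-proj₁-toList (px ∷ pxs) = cong (_ ∷_) (map-proj₁-toList pxs)

module Quotient {k} (S : System (suc k)) (1≤k : 1 ≤ k)
                (has-twin : ∀ u → ∃ λ v → v ≢ u × System.Twin S u v) where

  open System S

  σ : V → V
  σ u = proj₁ (has-twin u)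

  σ≢ : ∀ u → σ u ≢ u
  σ≢ u = proj₁ (proj₂ (has-twin u))

  label-injective : ∀ {x b b′} → child b x ≡ child b′ x → b ≡ b′
  label-injective eq = ∷-injectiveˡ (geodetic [ _ ] [ _ ] (s≤s z≤n) (s≤s z≤n) eq)

  -- The in-degree is 2, and a and its twin already account for both parents of x.
  common-child : ∀ {w a x} → Parent w x → Parent a x → w ≡ a ⊎ w ≡ σ a
  common-child {a = a} {x} Pw Pa@(b , refl) with parents x
  ... | p , q , _ , _ , _ , only with only Pw | only Pa | only (proj₂ (proj₂ (has-twin a)) b)
  ... | inj₁ w≡p | inj₁ a≡p | _         = inj₁ (trans w≡p (sym a≡p))
  ... | inj₂ w≡q | inj₂ a≡q | _         = inj₁ (trans w≡q (sym a≡q))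
  ... | inj₁ w≡p | inj₂ _   | inj₁ σa≡p = inj₂ (trans w≡p (sym σa≡p))
  ... | inj₁ _   | inj₂ a≡q | inj₂ σa≡q = contradiction (trans σa≡q (sym a≡q)) (σ≢ a)
  ... | inj₂ w≡q | inj₁ _   | inj₂ σa≡q = inj₂ (trans w≡q (sym σa≡q))
  ... | inj₂ _   | inj₁ a≡p | inj₁ σa≡p = contradiction (trans σa≡p (sym a≡p)) (σ≢ a)

  σ-involutive : ∀ u → σ (σ u) ≡ u
  σ-involutive u with common-child {u} {σ u} (false , refl) (proj₂ (proj₂ (has-twin u)) false)
  ... | inj₁ u≡σu  = contradiction (sym u≡σu) (σ≢ u)
  ... | inj₂ u≡σσu = sym u≡σσu

  σ-twin : ∀ u → Twin (σ u) u
  σ-twin u = subst (Twin (σ u)) (σ-involutive u) (proj₂ (proj₂ (has-twin (σ u))))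

  -- The index chooses one vertex of each twin pair. Proofs of `<` are unique, so equality in `V/σ`
  -- is equality of the chosen vertices.
  Rep : V → Set
  Rep u = idx u < idx (σ u)

  Rep? : ∀ u → Dec (Rep u)
  Rep? u = idx u <? idx (σ u)

  ¬Rep⇒Rep-σ : ∀ u → ¬ Rep u → Rep (σ u)
  ¬Rep⇒Rep-σ u ¬Ru = subst (λ x → idx (σ u) < idx x) (sym (σ-involutive u))
    (≤∧≢⇒< (≮⇒≥ ¬Ru) (σ≢ u ∘ idx-injective))

  Rep⇒¬Rep-σ : ∀ u → Rep u → ¬ Rep (σ u)
  Rep⇒¬Rep-σ u Ru Rσu = <-asym Ru (subst (λ x → idx (σ u) < idx x) (σ-involutive u) Rσu)

  V/σ : Set
  V/σ = ∃ Rep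

  proj₁-injective : ∀ {x y : V/σ} → proj₁ x ≡ proj₁ y → x ≡ y
  proj₁-injective {_ , p} {_ , q} refl = cong (_ ,_) (<-irrelevant p q)

  rep : V → V/σ
  rep u with Rep? u
  ... | yes Ru = u , Ru
  ... | no ¬Ru = σ u , ¬Rep⇒Rep-σ u ¬Ru

  rep-cases : ∀ u → proj₁ (rep u) ≡ u ⊎ proj₁ (rep u) ≡ σ u
  rep-cases u with Rep? u
  ... | yes _ = inj₁ refl
  ... | no  _ = inj₂ refl

  rep-unique : ∀ {u} (r : V/σ) → proj₁ r ≡ u ⊎ proj₁ r ≡ σ u → rep u ≡ r
  rep-unique {u} r@(_ , R) cases with Rep? u | cases
  ... | yes _  | inj₁ refl = proj₁-injective refl
  ... | yes Ru | inj₂ refl = contradiction R (Rep⇒¬Rep-σ u Ru)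
  ... | no ¬Ru | inj₁ refl = contradiction R ¬Ru
  ... | no _   | inj₂ refl = proj₁-injective refl

  rep-proj₁ : ∀ r → rep (proj₁ r) ≡ r
  rep-proj₁ r = rep-unique r (inj₁ refl)

  rep-twin : ∀ u → Twin (proj₁ (rep u)) u
  rep-twin u with Rep? u
  ... | yes _ = λ b → b , refl
  ... | no  _ = σ-twin u

  -- Twins may label the arcs to their common children differently; this translates a label of the
  -- representative into one of u.
  relabel : V → Bool → Bool
  relabel u b = proj₁ (rep-twin u b)

  relabel-child : ∀ u b → child (relabel u b) u ≡ child b (proj₁ (rep u))
  relabel-child u b = proj₂ (rep-twin u b)

  relabel-injective : ∀ u {b b′} → relabel u b ≡ relabel u b′ → b ≡ b′
  relabel-injective u {b} {b′} eq = label-injective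
    (trans (sym (relabel-child u b)) (trans (cong (λ b → child b u) eq) (relabel-child u b′)))

  child/σ : Bool → V/σ → V/σ
  child/σ b r = rep (child b (proj₁ r))

  -- A walk of classes lifts to a walk from either member of its first class, since twins have the
  -- same children.
  lift : Word → V → Word
  lift []      u = []
  lift (b ∷ w) u = relabel u b ∷ lift w (child (relabel u b) u)

  length-lift : ∀ w u → length (lift w u) ≡ length w
  length-lift []      u = refl
  length-lift (b ∷ w) u = cong suc (length-lift w _)

  lift-injective : ∀ w w′ u → lift w u ≡ lift w′ u → w ≡ w′
  lift-injective []      []        u eq = refl
  lift-injective (b ∷ w) (b′ ∷ w′) u eq with relabel-injective u (∷-injectiveˡ eq)
  ... | refl = cong (b ∷_) (lift-injective w w′ _ (∷-injectiveʳ eq))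

  follow-lift : ∀ w u → follow child/σ w (rep u) ≡ rep (act (lift w u) u)
  follow-lift []      u = refl
  follow-lift (b ∷ w) u = trans (cong (λ x → follow child/σ w (rep x)) (sym (relabel-child u b))) (follow-lift w _)

  act-lift-∷ʳ : ∀ w b u → act (lift (w ∷ʳ b) u) u ≡ child b (proj₁ (rep (act (lift w u) u)))
  act-lift-∷ʳ []       b u = relabel-child u b
  act-lift-∷ʳ (b′ ∷ w) b u = act-lift-∷ʳ w b _

  -- Twins have the same children, so equal endpoints downstairs give equal
  -- endpoints upstairs after one more step: this costs one unit of k.
  geodetic/σ : ∀ {r} w w′ → length w ≤ k → length w′ ≤ k → follow child/σ w r ≡ follow child/σ w′ r → w ≡ w′
  geodetic/σ {r} w w′ l l′ eq = ∷ʳ-injectiveˡ w w′ (lift-injective (w ∷ʳ false) (w′ ∷ʳ false) u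
    (geodetic _ _ (bound w l) (bound w′ l′) (begin
      act (lift (w ∷ʳ false) u) u                    ≡⟨ act-lift-∷ʳ w false u ⟩
      child false (proj₁ (rep (act (lift w u) u)))   ≡⟨ cong (child false ∘ proj₁) same ⟩
      child false (proj₁ (rep (act (lift w′ u) u)))  ≡⟨ act-lift-∷ʳ w′ false u ⟨
      act (lift (w′ ∷ʳ false) u) u                   ∎)))
    where
    open ≡-Reasoning
    u : V
    u = proj₁ r
    bound : ∀ w → length w ≤ k → length (lift (w ∷ʳ false) u) ≤ suc k
    bound w l = ≤-trans (≤-reflexive (trans (length-lift (w ∷ʳ false) u) (length-∷ʳ w false))) (s≤s l)
    down : ∀ w → rep (act (lift w u) u) ≡ follow child/σ w r
    down w = trans (sym (follow-lift w u)) (cong (follow child/σ w) (rep-proj₁ r))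
    same : rep (act (lift w u) u) ≡ rep (act (lift w′ u) u)
    same = trans (down w) (trans eq (sym (down w′)))

  Parent/σ : V/σ → V/σ → Set
  Parent/σ r s = ∃ λ b → child/σ b r ≡ s

  rep-parent : ∀ {a x} → Parent a x → Parent (proj₁ (rep a)) x
  rep-parent {a} (b , eq) with Rep? a
  ... | yes _ = b , eq
  ... | no  _ with proj₂ (proj₂ (has-twin a)) b
  ...   | b′ , eq′ = b′ , trans eq′ eq

  parent-rep : ∀ {a x} → Parent a x → Parent/σ (rep a) (rep x)
  parent-rep Pa with rep-parent Pa
  ... | b , eq = b , cong rep eq

  common-child-rep : ∀ {w a x} → Parent w x → Parent a x → rep w ≡ rep a
  common-child-rep {w} {a} Pw Pa = rep-unique (rep a) (both (common-child Pw Pa) (rep-cases a))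
    where
    both : w ≡ a ⊎ w ≡ σ a → proj₁ (rep a) ≡ a ⊎ proj₁ (rep a) ≡ σ a → proj₁ (rep a) ≡ w ⊎ proj₁ (rep a) ≡ σ w
    both (inj₁ refl) c        = c
    both (inj₂ refl) (inj₁ e) = inj₂ (trans e (sym (σ-involutive a)))
    both (inj₂ refl) (inj₂ e) = inj₁ e

  -- Twin siblings would give their parent two paths of length 2 to the same vertex, which geodecity
  -- forbids as k + 1 ≥ 2.
  σ-not-sibling : ∀ {a x} → Parent a x → ¬ Parent a (σ x)
  σ-not-sibling {a} {x} (b , bx) (b′ , b′x) with proj₂ (proj₂ (has-twin x)) false
  ... | b″ , eq with ∷-injectiveˡ (geodetic (b ∷ [ false ]) (b′ ∷ [ b″ ]) (s≤s 1≤k) (s≤s 1≤k)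
                      (trans (cong (child false) bx) (trans (sym eq) (sym (cong (child b″) b′x)))))
  ...   | refl = σ≢ x (trans (sym b′x) bx)

  -- The parents of x form one twin pair and those of σ x another, so each member of the class
  -- contributes one parent class.
  parents/σ : ∀ s → ∃ λ p → ∃ λ q → p ≢ q × Parent/σ p s × Parent/σ q s ×
              (∀ {r} → Parent/σ r s → r ≡ p ⊎ r ≡ q)
  parents/σ s@(x , _) with parents x | parents (σ x)
  ... | a , _ , _ , Pa , _ | d , _ , _ , Pd , _ =
    rep a , rep d , distinct , subst (Parent/σ (rep a)) (rep-proj₁ s) (parent-rep Pa)
    , subst (Parent/σ (rep d)) (rep-unique s (inj₂ (sym (σ-involutive x)))) (parent-rep Pd) , only
    where
    distinct : rep a ≢ rep d
    distinct eq = σ-not-sibling (rep-parent Pa) (subst (λ r → Parent (proj₁ r) (σ x)) (sym eq) (rep-parent Pd))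
    only : ∀ {r} → Parent/σ r s → r ≡ rep a ⊎ r ≡ rep d
    only {r} (b , eq) with rep-cases (child b (proj₁ r))
    ... | inj₁ e = inj₁ (trans (sym (rep-proj₁ r)) (common-child-rep (b , trans (sym e) (cong proj₁ eq)) Pa))
    ... | inj₂ e = inj₂ (trans (sym (rep-proj₁ r)) (common-child-rep
            (b , trans (sym (σ-involutive _)) (cong σ (trans (sym e) (cong proj₁ eq)))) Pd))

  reps : List V
  reps = filter Rep? vertices

  reps/σ : List V/σ
  reps/σ = All.toList (All.all-filter Rep? vertices)

  map-reps/σ : map proj₁ reps/σ ≡ reps
  map-reps/σ = map-proj₁-toList (All.all-filter Rep? vertices)

  complete/σ : ∀ r → r ∈ reps/σ
  complete/σ r@(u , Ru) with ∈-map⁻ proj₁ (subst (u ∈_) (sym map-reps/σ) (∈-filter⁺ Rep? (complete u) Ru))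
  ... | r′ , r′∈ , u≡ = subst (_∈ reps/σ) (sym (proj₁-injective u≡)) r′∈

  quotient : System k
  quotient = record
    { V             = V/σ
    ; idx           = idx ∘ proj₁
    ; idx-injective = proj₁-injective ∘ idx-injective
    ; vertices      = reps/σ
    ; unique        = Unique.map⁻ (subst Unique (sym map-reps/σ) (Unique.filter⁺ Rep? unique))
    ; complete      = complete/σ
    ; child         = child/σ
    ; geodetic      = geodetic/σ
    ; parents       = parents/σ
    }

  order-quotient : length vertices ≡ 2 * length reps/σ
  order-quotient = begin
    length vertices                         ≡⟨ ≤-antisym (unique-⊆⇒≤ unique covers) (unique-⊆⇒≤ both-unique (λ _ → complete _)) ⟩
    length (reps ++ map σ reps)             ≡⟨ length-++ reps ⟩
    length reps + length (map σ reps)       ≡⟨ cong (length reps +_) (trans (length-map σ reps) (sym (+-identityʳ _))) ⟩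
    2 * length reps                         ≡⟨ cong (λ xs → 2 * length xs) map-reps/σ ⟨
    2 * length (map proj₁ reps/σ)           ≡⟨ cong (2 *_) (length-map proj₁ reps/σ) ⟩
    2 * length reps/σ                       ∎
    where
    open ≡-Reasoning
    covers : vertices ⊆ reps ++ map σ reps
    covers {u} u∈ with Rep? u
    ... | yes Ru = ∈-++⁺ˡ (∈-filter⁺ Rep? u∈ Ru)
    ... | no ¬Ru = ∈-++⁺ʳ reps (subst (_∈ map σ reps) (σ-involutive u)
                     (∈-map⁺ σ (∈-filter⁺ Rep? (complete (σ u)) (¬Rep⇒Rep-σ u ¬Ru))))
    disjoint : ∀ {u} → u ∈ reps × u ∈ map σ reps → ⊥
    disjoint (u∈ , u∈σ) with ∈-map⁻ σ u∈σ
    ... | x , x∈ , refl = Rep⇒¬Rep-σ x (proj₂ (∈-filter⁻ Rep? {xs = vertices} x∈)) (proj₂ (∈-filter⁻ Rep? {xs = vertices} u∈))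
    both-unique : Unique (reps ++ map σ reps)
    both-unique = Unique.++⁺ (Unique.filter⁺ Rep? unique)
      (Unique.map⁺ (λ {x} {y} eq → trans (sym (σ-involutive x)) (trans (cong σ eq) (σ-involutive y))) (Unique.filter⁺ Rep? unique))
      disjoint

-- Parity of the order

M-suc : ∀ j → M 2 (suc j) ≡ suc (2 * M 2 j)
M-suc zero    = refl
M-suc (suc j) = begin
  M 2 (suc j) + 2 * 2 ^ suc j          ≡⟨ cong (_+ 2 * 2 ^ suc j) (M-suc j) ⟩
  suc (2 * M 2 j + 2 * 2 ^ suc j)      ≡⟨ cong suc (*-distribˡ-+ 2 (M 2 j) (2 ^ suc j)) ⟨
  suc (2 * M 2 (suc j))                ∎
  where open ≡-Reasoning

no-system-of-excess-2 : ∀ {k} (S : System k) → 3 ≤ k → length (System.vertices S) ≢ M 2 k + 2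
no-system-of-excess-2 {suc k} S (s≤s 2≤k) order≡ = even≢odd (length reps/σ) (M 2 k + 1) (begin
  2 * length reps/σ          ≡⟨ order-quotient ⟨
  length (System.vertices S) ≡⟨ order≡ ⟩
  M 2 (suc k) + 2            ≡⟨ cong (_+ 2) (M-suc k) ⟩
  suc (2 * M 2 k + 2)        ≡⟨ cong suc (*-distribˡ-+ 2 (M 2 k) 1) ⟨
  suc (2 * (M 2 k + 1))      ∎)
  where
  open ≡-Reasoning
  open Core S 2≤k (s≤s (s≤s z≤n)) 2≤k (≤-reflexive order≡) using (has-twin)
  open Quotient S (≤-trans (s≤s z≤n) 2≤k) has-twin using (reps/σ; order-quotient)

no-system-of-excess-3 : ∀ {k} (S : System k) → 4 ≤ k → length (System.vertices S) ≢ M 2 k + 3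
no-system-of-excess-3 {suc k} S (s≤s 3≤k) order≡ =
  no-system-of-excess-2 quotient 3≤k (*-cancelˡ-≡ _ _ 2 (begin
    2 * length reps/σ          ≡⟨ order-quotient ⟨
    length (System.vertices S) ≡⟨ order≡ ⟩
    M 2 (suc k) + 3            ≡⟨ cong (_+ 3) (M-suc k) ⟩
    suc (2 * M 2 k + 3)        ≡⟨ +-suc (2 * M 2 k) 3 ⟨
    2 * M 2 k + 4              ≡⟨ *-distribˡ-+ 2 (M 2 k) 2 ⟨
    2 * (M 2 k + 2)            ∎))
  where
  open ≡-Reasoning
  open Core S (≤-trans (n≤1+n 2) 3≤k) ≤-refl 3≤k (≤-reflexive order≡) using (has-twin)
  open Quotient S (≤-trans (s≤s z≤n) 3≤k) has-twin using (quotient; reps/σ; order-quotient)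

-- From digraphs to systems

sum≡0 : ∀ {n} (f : Fin n → ℕ) → sum (tabulate f) ≡ 0 → ∀ i → ¬ Fin (f i)
sum≡0 {suc n} f eq i       a with f fzero in f₀
sum≡0 {suc n} f eq fzero    a | zero  = ¬Fin0 (subst Fin f₀ a)
sum≡0 {suc n} f eq (fsuc i) a | zero  = sum≡0 (f ∘ fsuc) eq i a
sum≡0 {suc n} f () i        a | suc _

sum≡1 : ∀ {n} (f : Fin n → ℕ) → (∀ i → f i ≤ 1) → sum (tabulate f) ≡ 1 →
        ∃ λ i → Fin (f i) × (∀ j → Fin (f j) → j ≡ i)
sum≡1 {suc n} f f≤1 eq with f fzero in f₀
... | suc (suc _) = contradiction (subst (_≤ 1) f₀ (f≤1 fzero)) λ { (s≤s ()) }
... | suc zero    = fzero , subst Fin (sym f₀) fzero , λ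
  { fzero    _ → refl
  ; (fsuc j) a → contradiction a (sum≡0 (f ∘ fsuc) (suc-injective eq) j) }
... | zero with sum≡1 (f ∘ fsuc) (f≤1 ∘ fsuc) eq
...   | i , a , only = fsuc i , a , λ
  { fzero    a → contradiction (subst Fin f₀ a) ¬Fin0
  ; (fsuc j) a → cong fsuc (only j a) }

sum≡2 : ∀ {n} (f : Fin n → ℕ) → (∀ i → f i ≤ 1) → sum (tabulate f) ≡ 2 →
        ∃ λ i → ∃ λ j → i ≢ j × Fin (f i) × Fin (f j) × (∀ l → Fin (f l) → l ≡ i ⊎ l ≡ j)
sum≡2 {suc n} f f≤1 eq with f fzero in f₀
... | suc (suc _) = contradiction (subst (_≤ 1) f₀ (f≤1 fzero)) λ { (s≤s ()) }
... | suc zero with sum≡1 (f ∘ fsuc) (f≤1 ∘ fsuc) (suc-injective eq)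
...   | j , a , only = fzero , fsuc j , (λ ()) , subst Fin (sym f₀) fzero , a , λ
  { fzero    _ → inj₁ refl
  ; (fsuc l) a → inj₂ (cong fsuc (only l a)) }
sum≡2 {suc n} f f≤1 eq | zero with sum≡2 (f ∘ fsuc) (f≤1 ∘ fsuc) eq
...   | i , j , i≢j , a , b , only = fsuc i , fsuc j , i≢j ∘ suc-injectiveᶠ , a , b , λ
  { fzero    a → contradiction (subst Fin f₀ a) ¬Fin0
  ; (fsuc l) a → Sum.map (cong fsuc) (cong fsuc) (only l a) }

module FromDigraph (G : Digraph) {k} (1≤k : 1 ≤ k) (geo : Geodetic k G) (regular : Diregular 2 G) where

  open Digraph G using (Vertex; Arc; Path; arcs) renaming (length to ∣_∣)

  no-parallel-arcs : ∀ x y → arcs x y ≤ 1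
  no-parallel-arcs x y = at-most-one (arcs x y) λ a b → head≡ (geo x y (a ◅ ε) (b ◅ ε) 1≤k 1≤k)
    where
    head≡ : ∀ {a b : Arc x y} → _≡_ {A = Path x y} (a ◅ ε) (b ◅ ε) → a ≡ b
    head≡ refl = refl
    at-most-one : ∀ m → (∀ (a b : Fin m) → a ≡ b) → m ≤ 1
    at-most-one zero          _ = z≤n
    at-most-one (suc zero)    _ = ≤-refl
    at-most-one (suc (suc m)) h with h fzero (fsuc fzero)
    ... | ()

  out-neighbours : ∀ x → ∃ λ y → ∃ λ z → y ≢ z × Arc x y × Arc x z × (∀ l → Arc x l → l ≡ y ⊎ l ≡ z)
  out-neighbours x = sum≡2 (arcs x) (no-parallel-arcs x) (proj₂ (regular x))

  in-neighbours : ∀ x → ∃ λ u → ∃ λ v → u ≢ v × Arc u x × Arc v x × (∀ l → Arc l x → l ≡ u ⊎ l ≡ v)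
  in-neighbours x = sum≡2 (λ u → arcs u x) (λ u → no-parallel-arcs u x) (proj₁ (regular x))

  child : Bool → Vertex → Vertex
  child false x = proj₁ (out-neighbours x)
  child true  x = proj₁ (proj₂ (out-neighbours x))

  child-distinct : ∀ {b b′} x → child b x ≡ child b′ x → b ≡ b′
  child-distinct {false} {false} x _  = refl
  child-distinct {true}  {true}  x _  = refl
  child-distinct {false} {true}  x eq = contradiction eq (proj₁ (proj₂ (proj₂ (out-neighbours x))))
  child-distinct {true}  {false} x eq = contradiction (sym eq) (proj₁ (proj₂ (proj₂ (out-neighbours x))))

  arc : ∀ b x → Arc x (child b x)
  arc false x = proj₁ (proj₂ (proj₂ (proj₂ (out-neighbours x))))
  arc true  x = proj₁ (proj₂ (proj₂ (proj₂ (proj₂ (out-neighbours x)))))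

  arc⇒child : ∀ {x y} → Arc x y → ∃ λ b → child b x ≡ y
  arc⇒child {x} {y} a with proj₂ (proj₂ (proj₂ (proj₂ (proj₂ (out-neighbours x))))) y a
  ... | inj₁ y≡ = false , sym y≡
  ... | inj₂ y≡ = true , sym y≡

  path : ∀ w x → Path x (follow child w x)
  path []      x = ε
  path (b ∷ w) x = arc b x ◅ path w (child b x)

  length-path : ∀ w x → ∣ path w x ∣ ≡ length w
  length-path []      x = refl
  length-path (b ∷ w) x = cong suc (length-path w (child b x))

  -- Vertex lists can be compared without transport along equal endpoints, and they determine the
  -- labels because the two children of a vertex differ.
  trail : ∀ {x y} → Path x y → List Vertex
  trail ε             = []
  trail (_◅_ {j = y} _ p) = y ∷ trail p

  trail-injective : ∀ w w′ x → trail (path w x) ≡ trail (path w′ x) → w ≡ w′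
  trail-injective []      []        x eq = refl
  trail-injective (b ∷ w) (b′ ∷ w′) x eq with child-distinct {b} {b′} x (∷-injectiveˡ eq)
  ... | refl = cong (b ∷_) (trail-injective w w′ (child b x) (∷-injectiveʳ eq))

  -- The endpoints y and z are kept apart because two words give endpoints that are only
  -- propositionally equal.
  same-trail : ∀ {x y z} (p : Path x y) (q : Path x z) → ∣ p ∣ ≤ k → ∣ q ∣ ≤ k → y ≡ z → trail p ≡ trail q
  same-trail p q lp lq refl = cong trail (geo _ _ p q lp lq)

  system : System k
  system = record
    { V             = Vertex
    ; idx           = toℕ
    ; idx-injective = toℕ-injective
    ; vertices      = allFin (order G)
    ; unique        = Unique.allFin⁺ (order G)
    ; complete      = ∈-allFin
    ; child         = child
    ; geodetic      = λ {x} w w′ l l′ eq → trail-injective w w′ x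
        (same-trail (path w x) (path w′ x) (subst (_≤ k) (sym (length-path w x)) l)
                    (subst (_≤ k) (sym (length-path w′ x)) l′) eq)
    ; parents       = λ x → let u , v , u≢v , a , b , only = in-neighbours x in
        u , v , u≢v , arc⇒child a , arc⇒child b , λ { {w} (b , refl) → only w (arc b w) }
    }

theorem4 : (k : ℕ) → 4 ≤ k → ¬ ∃ (λ (G : Digraph) → IsExcessDigraph 2 k 3 G × Diregular 2 G)
theorem4 k 4≤k (G , excess , regular) =
  no-system-of-excess-3 system 4≤k (trans (length-tabulate id) (IsExcessDigraph.order≡M+e excess))
  where open FromDigraph G (≤-trans (s≤s z≤n) 4≤k) (IsExcessDigraph.geodetic excess) regular
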